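{- For every finite colouring $\mathbb N=C_1\cup\dots\cup C_r$ and every $q\in\mathbb Q_{>0}$ there are $m\le r$ and a sequence $(x_i)_{i\in\mathbb N}$ of natural numbers such that $$\operatorname{FS}(x_i\mid i\in\mathbb N)\ \cup\ \left\{q\cdot\frac{\sum_{i\in G}x_i}{\sum_{i\in F}x_i}\ \middle|\ F,G\in\mathcal P_{\mathrm{fin}}(\mathbb N)\setminus\{\emptyset\},\ F<G\right\}\subseteq C_m.$$
   Context: $\mathbb N$ denotes the set of positive integers ($0\notin\mathbb N$). A finite colouring of $\mathbb N$ is a partition of $\mathbb N$ into finitely many pieces, called colours. $\mathcal P_{\mathrm{fin}}(\mathbb N)$ is the set of finite subsets of $\mathbb N$; for nonempty finite $F,G\subseteq\mathbb N$, $F<G$ means $\max F<\min G$. $\operatorname{FS}(x_i\mid i\in\mathbb N)=\{x_{i_1}+\dots+x_{i_k}\mid k\in\mathbb N,\ i_1<\dots<i_k\}$. -}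

module Defs where

open import Data.Fin.Base using (Fin)
open import Data.Integer.Base using (+_)
open import Data.List.Base using (map)
import Data.List.Extrema.Nat as Extrema
open import Data.List.NonEmpty.Base using (List⁺; _∷_; toList; head; tail)
open import Data.List.Relation.Unary.Linked using (Linked)
open import Data.Nat.Base using (ℕ; _<_; NonZero; ≢-nonZero; ≢-nonZero⁻¹)
open import Data.Nat.ListAction using (sum)
open import Data.Nat.Properties using (m+n≡0⇒m≡0)
open import Data.Product.Base using (∃; ∃₂; ∃-syntax; _×_)
open import Data.Rational.Base using (ℚ; _/_; _*_)
open import Function.Base using (_∘_)
open import Level using (0ℓ)
open import Relation.Binary.PropositionalEquality using (_≡_)
open import Relation.Unary using (Pred; _∈_)

-- A partition of the positive integers into r classes.  Every class is a set
-- of positive integers; a class is allowed to be empty.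
record IsColouring {r : ℕ} (C : Fin r → Pred ℕ 0ℓ) : Set where
  field
    positive : ∀ {i n} → n ∈ C i → NonZero n
    covers   : ∀ n → .{{NonZero n}} → ∃[ i ] n ∈ C i
    disjoint : ∀ {i j n} → n ∈ C i → n ∈ C j → i ≡ j

-- Nonempty finite sets of indices, as strictly increasing lists.  Sequences
-- are indexed from 0, which only shifts the indices: the index set matters
-- solely through its order.
record FinSet⁺ : Set where
  constructor mkFinSet⁺
  field
    elements   : List⁺ ℕ
    increasing : Linked _<_ (toList elements)

open FinSet⁺ public

-- The first argument of Extrema.max and Extrema.min also takes part in the
-- comparison, so these are the extrema of the whole nonempty list.
maxᶠ minᶠ : FinSet⁺ → ℕ
maxᶠ F = Extrema.max (head (elements F)) (tail (elements F))
minᶠ F = Extrema.min (head (elements F)) (tail (elements F))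

infix 4 _<ᶠ_
_<ᶠ_ : FinSet⁺ → FinSet⁺ → Set
F <ᶠ G = maxᶠ F < minᶠ G

∑[_]_ : FinSet⁺ → (ℕ → ℕ) → ℕ
∑[ F ] x = sum (map x (toList (elements F)))

FS : (ℕ → ℕ) → Pred ℕ 0ℓ
FS x n = ∃[ F ] n ≡ ∑[ F ] x

∑-nonZero : ∀ {x} → (∀ i → NonZero (x i)) → ∀ F → NonZero (∑[ F ] x)
∑-nonZero {x} x≢0 (mkFinSet⁺ (i ∷ _) _) =
  ≢-nonZero (≢-nonZero⁻¹ (x i) {{x≢0 i}} ∘ m+n≡0⇒m≡0 (x i))

Quotients : ℚ → (x : ℕ → ℕ) → (∀ i → NonZero (x i)) → Pred ℚ 0ℓ
Quotients q x x≢0 p =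
  ∃₂ λ F G → F <ᶠ G × p ≡ q * ((+ ∑[ G ] x) / (∑[ F ] x)) {{∑-nonZero x≢0 F}}

-- The image of a set of naturals under the inclusion ℕ ⊆ ℚ.
inℚ : Pred ℕ 0ℓ → Pred ℚ 0ℓ
inℚ A p = ∃[ n ] n ∈ A × p ≡ + n / 1

{-# OPTIONS --safe #-}

-- By the Milliken–Taylor theorem for pairs, applied to the colour of q e / a,
-- there are positive y₀, y₁, … such that q ∑_G y / ∑_F y is a natural number of
-- one fixed colour m for all F < G.  Put xᵢ = q yᵢ₊₁ / y₀.  Then
-- ∑_F x = q ∑_{F+1} y / y₀ has colour m, and so has
-- q ∑_G x / ∑_F x = q ∑_{G+1} y / ∑_{F+1} y, where y₀ cancels.
--
-- The Milliken–Taylor theorem follows from Hindman's theorem by diagonalisation,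
-- and Hindman's theorem is proved in the manner of Baumgartner.  Idempotent
-- ultrafilters and sets of finite unions are both replaced by good sets: subsets
-- of a semigroup that contain elements of arbitrarily late start, and contain
-- a ∙ b whenever they contain a and b and b starts late enough in terms of a.

module Submission where

open import Axiom.ExcludedMiddle using (ExcludedMiddle)
open import Data.Empty using (⊥-elim)
open import Data.Fin.Base using (Fin; zero; suc)
open import Data.Integer.Base as ℤ using (+_; -[1+_])
import Data.Integer.Properties as ℤ
open import Data.List.Base using (List; []; _∷_; _++_; map)
open import Data.List.Extrema.Nat using (xs≤max; ⊥≤max; min≤⊤)
open import Data.List.Membership.Propositional using () renaming (_∈_ to _∈ˡ_)
open import Data.List.Membership.Propositional.Properties using (∈-++⁺ˡ; ∈-++⁺ʳ; ∈-map⁺)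
open import Data.List.NonEmpty.Base using (_∷_; toList; head)
open import Data.List.Relation.Unary.All as All using (All; []; _∷_)
open import Data.List.Relation.Unary.Any using (here; there)
open import Data.List.Relation.Unary.Linked using (Linked; [-]; _∷_)
open import Data.Nat.Base
  using (ℕ; zero; suc; _+_; _*_; _!; _⊔_; z≤n; s≤s; ≤′-refl; ≤′-step; NonZero; ≢-nonZero; ≢-nonZero⁻¹)
  renaming (_≤_ to _≤ⁿ_; _<_ to _<ⁿ_; _≤′_ to _≤ⁿ′_)
open import Data.Nat.Coprimality using (Coprime)
open import Data.Nat.Divisibility using (_∣_; divides; ∣-refl; ∣-trans; ∣m∣n⇒∣m+n; m∣m*n; m≤n⇒m!∣n!)
open import Data.Nat.ListAction using (sum)
open import Data.Nat.Properties
  using (≤-refl; ≤-trans; ≤-reflexive; ≤-<-trans; <-trans; <-≤-trans; n<1+n; <⇒≤; ≮⇒≥; ≤⇒≯; ≤⇒≤′;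
         m≤n⇒m<n∨m≡n; m≤m⊔n; m≤n⊔m; +-assoc; +-identityʳ; *-assoc; *-distribˡ-+; *-distribʳ-+;
         *-zeroʳ; *-cancelʳ-≡; m+n≡0⇒m≡0; m*n≢0; m*n≢0⇒m≢0; _!≢0)
open import Data.Nat.Solver using (module +-*-Solver)
open import Data.Product.Base using (Σ-syntax; ∃₂; ∃-syntax; _×_; _,_; proj₁; proj₂)
open import Data.Rational.Base using (ℚ; mkℚ; 0ℚ; _<_; _/_; *<*; toℚᵘ) renaming (_*_ to _*ℚ_)
open import Data.Rational.Properties using (toℚᵘ-injective; toℚᵘ-homo-*; toℚᵘ-fromℚᵘ)
open import Data.Rational.Unnormalised.Base as ℚᵘ using (mkℚᵘ; *≡*)
import Data.Rational.Unnormalised.Properties as ℚᵘ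
open import Data.Sum.Base using (inj₁; inj₂)
open import Level using (0ℓ)
open import Relation.Binary.PropositionalEquality
  using (_≡_; refl; sym; trans; cong; cong₂; subst; module ≡-Reasoning)
open import Relation.Nullary using (¬_; yes; no)
open import Relation.Unary using (Pred; _∪_; _⊆_; _∈_; _∉_)
open import Defs

module MillikenTaylor
  (em : ∀ {ℓ} → ExcludedMiddle ℓ)
  {S : Set} (_∙_ : S → S → S) (∙-assoc : ∀ x y z → (x ∙ y) ∙ z ≡ x ∙ (y ∙ z))
  (start : S → ℕ) (start-∙ : ∀ x y → start (x ∙ y) ≡ start x)
  where

  -- Good sets and restriction to late starts.

  ≤-start⁺ : ∀ {n x y} → n ≤ⁿ start x → n ≤ⁿ start (x ∙ y)
  ≤-start⁺ {x = x} {y} le = ≤-trans le (≤-reflexive (sym (start-∙ x y)))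

  ≤-start⁻ : ∀ {n x y} → n ≤ⁿ start (x ∙ y) → n ≤ⁿ start x
  ≤-start⁻ {x = x} {y} le = ≤-trans le (≤-reflexive (start-∙ x y))

  record Good (A : Pred S 0ℓ) : Set where
    field
      cofinal : ∀ n → ∃[ a ] a ∈ A × n ≤ⁿ start a
      closed  : ∀ {a} → a ∈ A → ∃[ n ] (∀ {b} → b ∈ A → n ≤ⁿ start b → (a ∙ b) ∈ A)

  open Good

  _↾_ : Pred S 0ℓ → ℕ → Pred S 0ℓ
  (A ↾ n) a = a ∈ A × n ≤ⁿ start a

  ↾-good : ∀ {A} → Good A → ∀ n → Good (A ↾ n)
  ↾-good gA n .cofinal k with cofinal gA (n ⊔ k)
  ... | a , a∈A , le = a , (a∈A , ≤-trans (m≤m⊔n n k) le) , ≤-trans (m≤n⊔m n k) le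
  ↾-good gA n .closed {a} (a∈A , n≤a) with closed gA a∈A
  ... | k , absorb = k , λ {b} (b∈A , _) k≤b →
    absorb b∈A k≤b , ≤-start⁺ n≤a

  after : ∀ {A a} → Good A → a ∈ A → ℕ
  after {a = a} gA a∈A = proj₁ (closed gA a∈A) ⊔ suc (start a)

  after-absorbs : ∀ {A a} (gA : Good A) (a∈A : a ∈ A) →
                  ∀ {b} → b ∈ A → after gA a∈A ≤ⁿ start b → (a ∙ b) ∈ A × start a <ⁿ start b
  after-absorbs {a = a} gA a∈A b∈A le =
    proj₂ (closed gA a∈A) b∈A (≤-trans (m≤m⊔n n (suc (start a))) le) ,
    ≤-trans (m≤n⊔m n (suc (start a))) le
    where n = proj₁ (closed gA a∈A)

  -- Blocks and fusion sequences.

  -- Products of terms of d, in order, over nonempty sets of indices in [n , m).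
  data Block (d : ℕ → S) : ℕ → ℕ → Pred S 0ℓ where
    single : ∀ {n i m} → n ≤ⁿ i → i <ⁿ m → Block d n m (d i)
    join   : ∀ {n k m x y} → Block d n k x → Block d k m y → Block d n m (x ∙ y)

  weakenˡ : ∀ {d n n′ m x} → n′ ≤ⁿ n → Block d n m x → Block d n′ m x
  weakenˡ le (single n≤i i<m) = single (≤-trans le n≤i) i<m
  weakenˡ le (join p q)       = join (weakenˡ le p) q

  block-< : ∀ {d n m x} → Block d n m x → n <ⁿ m
  block-< (single n≤i i<m) = ≤-<-trans n≤i i<m
  block-< (join p q)       = <-trans (block-< p) (block-< q)

  Blocks : (ℕ → S) → ℕ → Pred S 0ℓ
  Blocks d n x = ∃[ m ] Block d n m x

  decreasing : ∀ (A : ℕ → Pred S 0ℓ) → (∀ k → A (suc k) ⊆ A k) →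
               ∀ {n m} → n ≤ⁿ m → A m ⊆ A n
  decreasing A shrink n≤m = go (≤⇒≤′ n≤m)
    where
    go : ∀ {n m} → n ≤ⁿ′ m → A m ⊆ A n
    go ≤′-refl       x∈ = x∈
    go (≤′-step n≤m) x∈ = go n≤m (shrink _ x∈)

  -- Factors are absorbed from right to left: a term `d i` asks its right neighbour to lie in
  -- `A (suc i)`, and the decreasing sets bridge the gaps between indices.
  block-absorb : ∀ {d} (A : ℕ → Pred S 0ℓ) → (∀ k → A (suc k) ⊆ A k) →
                 (∀ k {x} → x ∈ A (suc k) → (d k ∙ x) ∈ A k) →
                 ∀ {n m x y} → Block d n m x → y ∈ A m → (x ∙ y) ∈ A n
  block-absorb A shrink absorb (single n≤i i<m) y∈ =
    decreasing A shrink n≤i (absorb _ (decreasing A shrink i<m y∈))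
  block-absorb A shrink absorb (join {n} {x = x} {y = y} p q) z∈ =
    subst (A n) (sym (∙-assoc x y _))
      (block-absorb A shrink absorb p (block-absorb A shrink absorb q z∈))

  -- These conditions put every product of terms from index `n` on in `A n`. They also make the
  -- starts of the terms strictly increasing, so that starts locate positions in the sequence.
  record Fusion (A : ℕ → Pred S 0ℓ) (d : ℕ → S) : Set where
    field
      pick   : ∀ k → d k ∈ A k
      shrink : ∀ k → A (suc k) ⊆ A k
      absorb : ∀ k {x} → x ∈ A (suc k) → (d k ∙ x) ∈ A k
      later  : ∀ k {x} → x ∈ A (suc k) → start (d k) <ⁿ start x

    block⊆ : ∀ {n m x} → Block d n m x → x ∈ A n
    block⊆ (single n≤i _) = decreasing A shrink n≤i (pick _)
    block⊆ (join p q)     = block-absorb A shrink absorb p (block⊆ q)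

    start-d-< : ∀ {i m} → i <ⁿ m → start (d i) <ⁿ start (d m)
    start-d-< i<m = later _ (decreasing A shrink i<m (pick _))

    start-d-≤ : ∀ {i m} → i ≤ⁿ m → start (d i) ≤ⁿ start (d m)
    start-d-≤ i≤m with m≤n⇒m<n∨m≡n i≤m
    ... | inj₁ i<m  = <⇒≤ (start-d-< i<m)
    ... | inj₂ refl = ≤-refl

    n≤start-d : ∀ n → n ≤ⁿ start (d n)
    n≤start-d zero    = z≤n
    n≤start-d (suc n) = ≤-<-trans (n≤start-d n) (start-d-< (n<1+n n))

    start≡start-d : ∀ {n m x} → Block d n m x → ∃[ i ] n ≤ⁿ i × i <ⁿ m × start x ≡ start (d i)
    start≡start-d (single n≤i i<m) = _ , n≤i , i<m , refl
    start≡start-d (join p q) with start≡start-d p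
    ... | i , n≤i , i<k , eq = i , n≤i , <-trans i<k (block-< q) , trans (start-∙ _ _) eq

    start-d≤start : ∀ {n m x} → Block d n m x → start (d n) ≤ⁿ start x
    start-d≤start p with start≡start-d p
    ... | i , n≤i , _ , eq = subst (start (d _) ≤ⁿ_) (sym eq) (start-d-≤ n≤i)

    start<start-d : ∀ {n m x} → Block d n m x → start x <ⁿ start (d m)
    start<start-d p with start≡start-d p
    ... | i , _ , i<m , eq = subst (_<ⁿ start (d _)) (sym eq) (start-d-< i<m)

    -- A block has the start of its first term, and the starts of terms increase, so a late start
    -- forces a late first index. This turns thresholds on starts, as in `Good`, into separation of
    -- blocks.
    block-start : ∀ {n m p x} → Block d n p x → start (d m) ≤ⁿ start x → Block d m p x
    block-start (single _ i<p) le = single (≮⇒≥ (λ i<m → ≤⇒≯ le (start-d-< i<m))) i<p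
    block-start (join p q)     le = join (block-start p (≤-start⁻ le)) q

    blocks-good : ∀ n → Good (Blocks d n)
    blocks-good n .cofinal k =
      d (n ⊔ k) , (suc (n ⊔ k) , single (m≤m⊔n n k) ≤-refl) ,
      ≤-trans (m≤n⊔m n k) (n≤start-d (n ⊔ k))
    blocks-good n .closed (m , p) =
      start (d m) , λ (k , q) le → k , join p (block-start q le)

  open Fusion

  -- Diagonalisation against all earlier products.

  module Diagonal
    {A : Pred S 0ℓ} (gA : Good A)
    (R : S → Pred (Pred S 0ℓ) 0ℓ)
    (antitone : ∀ {a B C} → C ⊆ B → R a B → R a C)
    (refine : ∀ {a B} → a ∈ A → Good B → B ⊆ A → ∃[ C ] Good C × C ⊆ B × R a C)
    where

    -- A stage faces only finitely many demands `R a`, so they can be met one after another;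
    -- `antitone` preserves those already met.
    refineAll : ∀ (as : List S) {B} → Good B → B ⊆ A →
                ∃[ C ] Good C × C ⊆ B × (∀ {a} → a ∈ˡ as → a ∈ A → R a C)
    refineAll []       {B} gB B⊆A = B , gB , (λ x∈ → x∈) , λ ()
    -- The list carries no proofs of membership in `A`; elements outside `A` make no demand.
    refineAll (a ∷ as) {B} gB B⊆A with refineAll as gB B⊆A | em {P = a ∈ A}
    ... | C , gC , C⊆B , RC | no a∉A  = C , gC , C⊆B , λ where
      (here refl) a∈A → ⊥-elim (a∉A a∈A)
      (there a∈)      → RC a∈
    ... | C , gC , C⊆B , RC | yes a∈A with refine a∈A gC (λ x∈ → B⊆A (C⊆B x∈))
    ...   | D , gD , D⊆C , RD = D , gD , (λ x∈ → C⊆B (D⊆C x∈)) , λ where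
      (here refl) _   → RD
      (there a∈)  b∈A → antitone {B = C} {C = D} D⊆C (RC a∈ b∈A)

    record Stage : Set₁ where
      field
        set  : Pred S 0ℓ
        good : Good set
        ⊆A   : set ⊆ A
        -- all products over blocks of the terms chosen so far
        past : List S

    open Stage

    choice : (s : Stage) → ∃[ a ] a ∈ set s
    choice s with cofinal (good s) 0
    ... | a , a∈ , _ = a , a∈

    extend : List S → S → List S
    extend as a = a ∷ as ++ map (_∙ a) as

    tail-⊆A : (s : Stage) → (set s ↾ after (good s) (proj₂ (choice s))) ⊆ A
    tail-⊆A s (x∈ , _) = ⊆A s x∈

    refined : (s : Stage) →
              ∃[ C ] Good C × C ⊆ (set s ↾ after (good s) (proj₂ (choice s))) ×
                (∀ {a} → a ∈ˡ extend (past s) (proj₁ (choice s)) → a ∈ A → R a C)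
    refined s = refineAll (extend (past s) (proj₁ (choice s)))
                  (↾-good (good s) (after (good s) (proj₂ (choice s)))) (tail-⊆A s)

    next : Stage → Stage
    next s = record
      { set  = proj₁ (refined s)
      ; good = proj₁ (proj₂ (refined s))
      ; ⊆A   = λ x∈ → tail-⊆A s (proj₁ (proj₂ (proj₂ (refined s))) x∈)
      ; past = extend (past s) (proj₁ (choice s))
      }

    stage : ℕ → Stage
    stage zero    = record { set = A ; good = gA ; ⊆A = λ x∈ → x∈ ; past = [] }
    stage (suc k) = next (stage k)

    sets : ℕ → Pred S 0ℓ
    sets k = set (stage k)

    terms : ℕ → S
    terms k = proj₁ (choice (stage k))

    next-⊆ : ∀ s {x} → x ∈ set (next s) → x ∈ (set s ↾ after (good s) (proj₂ (choice s)))
    next-⊆ s = proj₁ (proj₂ (proj₂ (refined s)))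

    fusion : Fusion sets terms
    fusion .pick k      = proj₂ (choice (stage k))
    fusion .shrink k x∈ = proj₁ (next-⊆ (stage k) x∈)
    fusion .absorb k x∈ with next-⊆ (stage k) x∈
    ... | y , le = proj₁ (after-absorbs (good (stage k)) (proj₂ (choice (stage k))) y le)
    fusion .later k x∈ with next-⊆ (stage k) x∈
    ... | y , le = proj₂ (after-absorbs (good (stage k)) (proj₂ (choice (stage k))) y le)

    pasts : ℕ → Pred S 0ℓ
    pasts k x = x ∈ˡ past (stage k)

    pasts-mono : ∀ {n m} → n ≤ⁿ m → pasts n ⊆ pasts m
    pasts-mono n≤m = go (≤⇒≤′ n≤m)
      where
      go : ∀ {n m} → n ≤ⁿ′ m → pasts n ⊆ pasts m
      go ≤′-refl       x∈ = x∈
      go (≤′-step n≤m) x∈ = there (∈-++⁺ˡ (go n≤m x∈))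

    -- The lists hold only left-bracketed products, while a `Block` may be bracketed anyhow.
    -- Appending its terms to `x` one at a time, up to associativity, reconciles the two.
    pasts-append : ∀ {n m x y} → x ∈ pasts n → Block terms n m y → (x ∙ y) ∈ pasts m
    pasts-append x∈ (single {i = i} n≤i i<m) =
      pasts-mono i<m (there (∈-++⁺ʳ (past (stage i)) (∈-map⁺ (_∙ terms i) (pasts-mono n≤i x∈))))
    pasts-append {m = m} {x} x∈ (join {x = y} {z} p q) =
      subst (pasts m) (∙-assoc x y z) (pasts-append (pasts-append x∈ p) q)

    block-past : ∀ {n m x} → Block terms n m x → x ∈ pasts m
    block-past (single _ i<m) = pasts-mono i<m (here refl)
    block-past (join p q)     = pasts-append (block-past p) q

    block-⊆A : ∀ {n m x} → Block terms n m x → x ∈ A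
    block-⊆A {n} p = ⊆A (stage n) (block⊆ fusion p)

    -- A block with indices at most `m` is in the list against which `sets (suc m)` was refined.
    block-R : ∀ {n m x} → Block terms n m x → R x (sets m)
    block-R {m = suc m} p = proj₂ (proj₂ (proj₂ (refined (stage m)))) (block-past p) (block-⊆A p)
    block-R {m = zero} p = ⊥-elim (empty p)
      where
      empty : ∀ {n x} → ¬ Block terms n 0 x
      empty (single _ ())
      empty (join _ q) = empty q

  diagonal : ∀ {A} → Good A → (R : S → Pred (Pred S 0ℓ) 0ℓ) →
    (∀ {a B C} → C ⊆ B → R a B → R a C) →
    (∀ {a B} → a ∈ A → Good B → B ⊆ A → ∃[ C ] Good C × C ⊆ B × R a C) →
    ∃₂ λ B d → Fusion B d × (∀ {n m x} → Block d n m x → x ∈ A) ×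
      (∀ {n m x} → Block d n m x → R x (B m))
  diagonal gA R antitone refine = sets , terms , fusion , block-⊆A , block-R
    where open Diagonal gA R (λ {a} {B} {C} → antitone {a} {B} {C}) refine

  -- Large sets and Hindman's theorem.

  Avoids : Pred S 0ℓ → Pred S 0ℓ → Set₁
  Avoids X A = ∃[ B ] Good B × B ⊆ A × (∀ {x} → x ∈ B → x ∉ X)

  -- By excluded middle, this says that every good subset of `A` meets `X`.
  Large : Pred S 0ℓ → Pred S 0ℓ → Set₁
  Large X A = ¬ Avoids X A

  large-antitone : ∀ {X A B} → B ⊆ A → Large X A → Large X B
  large-antitone B⊆A large (C , gC , C⊆B , avoids) =
    large (C , gC , (λ x∈ → B⊆A (C⊆B x∈)) , avoids)

  large-meets : ∀ {X A B} → Large X A → Good B → B ⊆ A → ∃[ x ] x ∈ B × x ∈ X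
  large-meets {X} {B = B} large gB B⊆A with em {P = ∃[ x ] x ∈ B × x ∈ X}
  ... | yes meets = meets
  ... | no ¬meets = ⊥-elim (large (_ , gB , B⊆A , λ x∈B x∈X → ¬meets (_ , x∈B , x∈X)))

  -- If `Q zero` is not large, pass to a good set avoiding it; there the union of the other classes
  -- is still large.
  large-partition : ∀ {r A} (Q : Fin r → Pred S 0ℓ) → Good A →
                    Large (λ x → ∃[ i ] x ∈ Q i) A →
                    ∃₂ λ i B → Good B × B ⊆ A × Large (Q i) B
  large-partition {zero}  {A} Q gA large = ⊥-elim (large (A , gA , (λ x∈ → x∈) , λ _ ()))
  large-partition {suc r} {A} Q gA large with em {P = Avoids (Q zero) A}
  ... | no large₀ = zero , A , gA , (λ x∈ → x∈) , large₀
  ... | yes (B , gB , B⊆A , avoids)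
    with large-partition (λ i → Q (suc i)) gB (λ (C , gC , C⊆B , av) →
           large (C , gC , (λ x∈ → B⊆A (C⊆B x∈)) , λ where
             x∈C (zero  , x∈Q) → avoids (C⊆B x∈C) x∈Q
             x∈C (suc i , x∈Q) → av x∈C (i , x∈Q)))
  ...   | i , C , gC , C⊆B , largeᵢ = suc i , C , gC , (λ x∈ → B⊆A (C⊆B x∈)) , largeᵢ

  -- If no a works, a diagonal sequence d has x ∙ y ∉ X whenever the block x
  -- precedes the block y ∈ X.  Such products x ∙ y form a good set, because
  -- (x ∙ y) ∙ (x′ ∙ y′) = ((x ∙ y) ∙ x′) ∙ y′; this set avoids X.
  large-translate : ∀ {X A} → Good A → Large X A →
                    ∃[ a ] a ∈ A × (∃[ B ] Good B × B ⊆ A × Large (λ x → x ∈ X × (a ∙ x) ∈ X) B)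
  large-translate {X} {A} gA large
    with em {P = ∃[ a ] a ∈ A × (∃[ B ] Good B × B ⊆ A × Large (λ x → x ∈ X × (a ∙ x) ∈ X) B)}
  ... | yes found = found
  ... | no ¬found
    with diagonal gA R (λ C⊆B r x∈ → r (C⊆B x∈)) refine
    where
    R : S → Pred (Pred S 0ℓ) 0ℓ
    R a B = ∀ {x} → x ∈ B → ¬ (x ∈ X × (a ∙ x) ∈ X)

    refine : ∀ {a B} → a ∈ A → Good B → B ⊆ A → ∃[ C ] Good C × C ⊆ B × R a C
    refine {a} {B} a∈A gB B⊆A with em {P = Avoids (λ x → x ∈ X × (a ∙ x) ∈ X) B}
    ... | yes avoids = avoids
    ... | no largeᵃ  = ⊥-elim (¬found (a , a∈A , B , gB , B⊆A , largeᵃ))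
  ...   | B , d , fus , block∈A , block-R = ⊥-elim (large (Z , Z-good , Z⊆A , Z-avoids))
    where
    Z : Pred S 0ℓ
    Z z = ∃₂ λ x y → ∃₂ λ m p → z ≡ x ∙ y × Block d 0 m x × Block d m p y × y ∈ X

    Z-good : Good Z
    Z-good .cofinal n
      with large-meets large (blocks-good fus (suc n)) (λ (_ , b) → block∈A b)
    ... | y , (p , by) , y∈X =
      d n ∙ y , (d n , y , suc n , p , refl , single z≤n ≤-refl , by , y∈X) ,
      ≤-start⁺ (n≤start-d fus n)
    Z-good .closed (x , y , m , p , refl , bx , by , y∈X) =
      start (d p) , λ where
        (x′ , y′ , m′ , p′ , refl , bx′ , by′ , y′∈X) le →
          (x ∙ y) ∙ x′ , y′ , m′ , p′ , sym (∙-assoc (x ∙ y) x′ y′) ,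
          join (join bx by) (block-start fus bx′ (≤-start⁻ le)) ,
          by′ , y′∈X

    Z⊆A : Z ⊆ A
    Z⊆A (_ , _ , _ , _ , refl , bx , by , _) = block∈A (join bx by)

    Z-avoids : ∀ {z} → z ∈ Z → z ∉ X
    Z-avoids (_ , _ , _ , _ , refl , bx , by , y∈X) z∈X = block-R bx (block⊆ fus by) (y∈X , z∈X)

  module LargeContainsGood {X A : Pred S 0ℓ} (gA : Good A) (large : Large X A) where

    record Stage : Set₁ where
      field
        set     : Pred S 0ℓ
        target  : Pred S 0ℓ
        good    : Good set
        isLarge : Large target set

    open Stage

    term : Stage → S
    term s = proj₁ (large-translate (good s) (isLarge s))

    term∈ : ∀ s → term s ∈ set s
    term∈ s = proj₁ (proj₂ (large-translate (good s) (isLarge s)))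

    -- The shrinking targets record what the chosen terms require: prefixing a block with indices in
    -- [n , m) carries target `m` into target `n`.
    next : Stage → Stage
    next s with large-translate (good s) (isLarge s)
    ... | a , a∈ , B , gB , B⊆ , largeB = record
      { set     = B ↾ after (good s) a∈
      ; target  = λ x → x ∈ target s × (a ∙ x) ∈ target s
      ; good    = ↾-good gB _
      ; isLarge = large-antitone proj₁ largeB
      }

    next-⊆ : ∀ s {x} → x ∈ set (next s) → x ∈ set s × after (good s) (term∈ s) ≤ⁿ start x
    next-⊆ s (x∈ , le) with large-translate (good s) (isLarge s)
    ... | a , a∈ , B , gB , B⊆ , largeB = B⊆ x∈ , le

    next-target : ∀ s {x} → x ∈ target (next s) → x ∈ target s × (term s ∙ x) ∈ target s
    next-target s x∈ with large-translate (good s) (isLarge s)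
    ... | a , a∈ , B , gB , B⊆ , largeB = x∈

    stage : ℕ → Stage
    stage zero    = record { set = A ; target = X ; good = gA ; isLarge = large }
    stage (suc k) = next (stage k)

    sets targets : ℕ → Pred S 0ℓ
    sets k    = set (stage k)
    targets k = target (stage k)

    terms : ℕ → S
    terms k = term (stage k)

    fusion : Fusion sets terms
    fusion .pick k      = term∈ (stage k)
    fusion .shrink k x∈ = proj₁ (next-⊆ (stage k) x∈)
    fusion .absorb k x∈ with next-⊆ (stage k) x∈
    ... | y , le = proj₁ (after-absorbs (good (stage k)) (term∈ (stage k)) y le)
    fusion .later k x∈ with next-⊆ (stage k) x∈
    ... | y , le = proj₂ (after-absorbs (good (stage k)) (term∈ (stage k)) y le)

    targets-⊆ : ∀ k → targets (suc k) ⊆ targets k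
    targets-⊆ k x∈ = proj₁ (next-target (stage k) x∈)

    targets-absorb : ∀ k {x} → x ∈ targets (suc k) → (terms k ∙ x) ∈ targets k
    targets-absorb k x∈ = proj₂ (next-target (stage k) x∈)

    meet : ∀ n → ∃[ x ] x ∈ Blocks terms n × x ∈ targets n
    meet n = large-meets (isLarge (stage n)) (blocks-good fusion n) (λ (_ , b) → block⊆ fusion b)

    -- The terms need not lie in their targets.  Regrouping them into blocks, of
    -- which the k-th lies in the target of its first possible index, repairs this.
    cut : ℕ → ℕ
    cut zero    = 0
    cut (suc k) = proj₁ (proj₁ (proj₂ (meet (cut k))))

    cut-block : ∀ k → Block terms (cut k) (cut (suc k)) (proj₁ (meet (cut k)))
    cut-block k = proj₂ (proj₁ (proj₂ (meet (cut k))))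

    cut-fusion : Fusion (λ k x → x ∈ Blocks terms (cut k) × x ∈ targets (cut k))
                        (λ k → proj₁ (meet (cut k)))
    cut-fusion .pick k   = proj₂ (meet (cut k))
    cut-fusion .shrink k ((m , b) , x∈) =
      (m , weakenˡ k≤ b) , decreasing targets targets-⊆ k≤ x∈
      where k≤ = <⇒≤ (block-< (cut-block k))
    cut-fusion .absorb k ((m , b) , x∈) =
      (m , join (cut-block k) b) , block-absorb targets targets-⊆ targets-absorb (cut-block k) x∈
    cut-fusion .later k ((m , b) , _) =
      <-≤-trans (start<start-d fusion (cut-block k)) (start-d≤start fusion b)

    contained : ∃[ B ] Good B × B ⊆ A × B ⊆ X
    contained =
      -- Since `cut 0` is 0, all regrouped blocks lie in `targets 0`, which is `X`, and in `sets 0`,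
      -- which is `A`.
      Blocks _ 0 , blocks-good cut-fusion 0 ,
      (λ (_ , b) → block⊆ fusion (proj₂ (proj₁ (block⊆ cut-fusion b)))) ,
      (λ (_ , b) → proj₂ (block⊆ cut-fusion b))

  -- The union of the classes contains `A`, hence is large. So one class is large in some good
  -- subset, and there it contains a good set.
  hindman : ∀ {r A} (Q : Fin r → Pred S 0ℓ) → Good A → (∀ {a} → a ∈ A → ∃[ i ] a ∈ Q i) →
            ∃₂ λ i B → Good B × B ⊆ A × B ⊆ Q i
  hindman {A = A} Q gA covers
    with large-partition Q gA (λ (B , gB , B⊆A , avoids) →
           let (b , b∈B , _) = cofinal gB 0 in avoids b∈B (covers (B⊆A b∈B)))
  ... | i , B , gB , B⊆A , largeB with LargeContainsGood.contained gB largeB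
  ...   | C , gC , C⊆B , C⊆Q = i , C , gC , (λ x∈ → B⊆A (C⊆B x∈)) , C⊆Q

  -- The Milliken-Taylor theorem for pairs.

  abstract
    -- Three passes: a diagonal sequence, refined by `hindman`, lets one colour chosen for a block
    -- serve with all later blocks; `hindman` then makes this colour constant; a second diagonal
    -- sequence replaces the remaining thresholds by mere order of blocks.
    millikenTaylor : ∀ {r A} (P : Fin r → S → S → Set) → Good A →
      (∀ {a} → a ∈ A → ∃[ n ] (∀ {b} → b ∈ A → n ≤ⁿ start b → ∃[ i ] P i a b)) →
      ∃₂ λ i d → (∀ k → d k ∈ A) ×
        (∀ {n k m x y} → Block d n k x → Block d k m y → P i x y)
    millikenTaylor {r} {A} P gA covers
      with diagonal gA (λ a B → ∃[ i ] (∀ {b} → b ∈ B → P i a b))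
             (λ C⊆B (i , f) → i , λ x∈ → f (C⊆B x∈)) refineToColour
      where
      refineToColour : ∀ {a B} → a ∈ A → Good B → B ⊆ A →
                       ∃[ C ] Good C × C ⊆ B × (∃[ i ] (∀ {b} → b ∈ C → P i a b))
      refineToColour {a} a∈A gB B⊆A with covers a∈A
      ... | n , cov
        with hindman (λ i b → P i a b) (↾-good gB n) (λ (b∈B , n≤b) → cov (B⊆A b∈B) n≤b)
      ...   | i , C , gC , C⊆B↾n , C⊆P = C , gC , (λ x∈ → proj₁ (C⊆B↾n x∈)) , i , C⊆P
    ... | B , d , fus , block∈A , block-R
      with hindman Q (blocks-good fus 0) Q-covers
      where
      Q : Fin r → Pred S 0ℓ
      Q i a = ∃[ n ] (∀ {b} → b ∈ Blocks d 0 → n ≤ⁿ start b → P i a b)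

      Q-covers : ∀ {a} → a ∈ Blocks d 0 → ∃[ i ] a ∈ Q i
      Q-covers (m , ba) with block-R ba
      ... | i , f = i , start (d m) , λ (_ , bb) le → f (block⊆ fus (block-start fus bb le))
    ...   | i , C , gC , C⊆F , C⊆Q
      with diagonal gC (λ a B → ∀ {b} → b ∈ B → P i a b) (λ C⊆B f x∈ → f (C⊆B x∈)) refineTail
      where
      refineTail : ∀ {a B} → a ∈ C → Good B → B ⊆ C →
                   ∃[ D ] Good D × D ⊆ B × (∀ {b} → b ∈ D → P i a b)
      refineTail {B = B} a∈C gB B⊆C with C⊆Q a∈C
      ... | n , f = B ↾ n , ↾-good gB n , proj₁ , λ (b∈B , n≤b) → f (C⊆F (B⊆C b∈B)) n≤b
    ...     | D , e , fusₑ , block∈C , blockₑ-R =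
      i , e , (λ k → block∈A (proj₂ (C⊆F (block∈C (single (z≤n {k}) ≤-refl))))) ,
      λ bx by → blockₑ-R bx (block⊆ fusₑ by)

-- Divisibility and rational arithmetic.

n∣n! : ∀ n .{{_ : NonZero n}} → n ∣ n !
n∣n! (suc n) = m∣m*n (n !)

-- In `ℚ` the fraction is reduced to lowest terms; among unnormalised rationals the claim becomes
-- cross-multiplication.
scaled-quotient : ∀ p b c g f .{{_ : NonZero f}} .{cop : Coprime p (suc b)} → p * g ≡ c * (suc b * f) →
                  mkℚ (+ p) b cop *ℚ (+ g / f) ≡ + c / 1
scaled-quotient p b c g f@(suc f-1) {cop} eq = toℚᵘ-injective (begin
  toℚᵘ (mkℚ (+ p) b cop *ℚ (+ g / f))         ≈⟨ toℚᵘ-homo-* (mkℚ (+ p) b cop) (+ g / f) ⟩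
  mkℚᵘ (+ p) b ℚᵘ.* toℚᵘ (+ g / f)            ≈⟨ ℚᵘ.*-congˡ {mkℚᵘ (+ p) b} (toℚᵘ-fromℚᵘ (mkℚᵘ (+ g) f-1)) ⟩
  mkℚᵘ (+ p) b ℚᵘ.* mkℚᵘ (+ g) f-1            ≈⟨ *≡* cross ⟩
  mkℚᵘ (+ c) 0                                ≈⟨ toℚᵘ-fromℚᵘ (mkℚᵘ (+ c) 0) ⟨
  toℚᵘ (+ c / 1)                              ∎)
  where
  open ℚᵘ.≃-Reasoning
  cross : (+ p ℤ.* + g) ℤ.* + 1 ≡ + c ℤ.* + (suc b * f)
  cross = trans (ℤ.*-identityʳ (+ p ℤ.* + g))
    (trans (sym (ℤ.pos-* p g)) (trans (cong +_ eq) (ℤ.pos-* c (suc b * f))))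

-- The first component is a level.  Among levelled pairs, level n makes the second
-- component divisible by every positive number up to n.
_⊕_ : ℕ × ℕ → ℕ × ℕ → ℕ × ℕ
(n , a) ⊕ (_ , b) = n , a + b

⊕-assoc : ∀ x y z → (x ⊕ y) ⊕ z ≡ x ⊕ (y ⊕ z)
⊕-assoc (n , a) (_ , b) (_ , c) = cong (n ,_) (+-assoc a b c)

Levelled : Pred (ℕ × ℕ) 0ℓ
Levelled (n , a) = NonZero a × n ! ∣ a

*-sum-proportional : ∀ p k (x y : ℕ → ℕ) → (∀ i → p * y i ≡ x i * k) →
                     ∀ is → p * sum (map y is) ≡ sum (map x is) * k
*-sum-proportional p k x y prop []       = *-zeroʳ p
*-sum-proportional p k x y prop (i ∷ is) = begin
  p * (y i + sum (map y is))       ≡⟨ *-distribˡ-+ p (y i) _ ⟩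
  p * y i + p * sum (map y is)     ≡⟨ cong₂ _+_ (prop i) (*-sum-proportional p k x y prop is) ⟩
  x i * k + sum (map x is) * k     ≡⟨ *-distribʳ-+ k (x i) _ ⟨
  (x i + sum (map x is)) * k       ∎
  where open ≡-Reasoning

-- Passing from `f`, `g` to `x`, `z` multiplies both by `p / k`, so their ratio, and with it `c`,
-- stays the same.
rescale : ∀ p b c k {f g x z} .{{_ : NonZero k}} →
          p * g ≡ c * (b * f) → p * f ≡ x * k → p * g ≡ z * k → p * z ≡ c * (b * x)
rescale p b c k {f} {g} {x} {z} ratio f∝x g∝z = *-cancelʳ-≡ (p * z) (c * (b * x)) k (begin
  p * z * k           ≡⟨ *-assoc p z k ⟩
  p * (z * k)         ≡⟨ cong (p *_) g∝z ⟨
  p * (p * g)         ≡⟨ cong (p *_) ratio ⟩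
  p * (c * (b * f))   ≡⟨ solve 4 (λ p b c f → p :* (c :* (b :* f)) := c :* (b :* (p :* f))) refl p b c f ⟩
  c * (b * (p * f))   ≡⟨ cong (λ t → c * (b * t)) f∝x ⟩
  c * (b * (x * k))   ≡⟨ solve 4 (λ b c k x → c :* (b :* (x :* k)) := c :* (b :* x) :* k) refl b c k x ⟩
  c * (b * x) * k     ∎)
  where
  open ≡-Reasoning
  open +-*-Solver

elements≤max : ∀ F → All (_≤ⁿ maxᶠ F) (toList (elements F))
elements≤max (mkFinSet⁺ (i ∷ is) _) = ⊥≤max i is ∷ xs≤max i is

-- Coloured ratios and the rescaled sequence.

module _ (em : ∀ {ℓ} → ExcludedMiddle ℓ) where

  open MillikenTaylor em _⊕_ ⊕-assoc proj₁ (λ _ _ → refl)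

  levelled-good : Good Levelled
  levelled-good .Good.cofinal n = (n , n !) , ((n !≢0) , ∣-refl) , ≤-refl
  levelled-good .Good.closed {n , a} (a≢0 , n!∣a) =
    n , λ (_ , m!∣b) n≤m →
      ≢-nonZero (λ a+b≡0 → ≢-nonZero⁻¹ a {{a≢0}} (m+n≡0⇒m≡0 a a+b≡0)) ,
      ∣m∣n⇒∣m+n n!∣a (∣-trans (m≤n⇒m!∣n! n≤m) m!∣b)

  sum-block : ∀ (d : ℕ → ℕ × ℕ) {m n i is} → n ≤ⁿ i → All (_<ⁿ m) (i ∷ is) → Linked _<ⁿ_ (i ∷ is) →
              ∃[ x ] Block d n m x × proj₂ x ≡ sum (map (λ j → proj₂ (d j)) (i ∷ is))
  sum-block d {i = i} n≤i (i<m ∷ []) [-] = d i , single n≤i i<m , sym (+-identityʳ _)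
  sum-block d {i = i} n≤i (i<m ∷ is<m) (i<j ∷ inc) with sum-block d i<j is<m inc
  -- The cut is placed at `suc i`, just after the first index.
  ... | x , b , eq = d i ⊕ x , join (single n≤i ≤-refl) b , cong (λ t → proj₂ (d i) + t) eq

  block-shift : ∀ {d n m x} → Block (λ i → d (suc i)) n m x → Block d (suc n) (suc m) x
  block-shift (single n≤i i<m) = single (s≤s n≤i) (s≤s i<m)
  block-shift (join b b′)      = join (block-shift b) (block-shift b′)

  module Construction
    {r} (C : Fin r → Pred ℕ 0ℓ) (colouring : IsColouring C) (p b : ℕ)
    where

    open IsColouring colouring using (covers) renaming (positive to class-positive)

    -- With q = `suc p / suc b`, this is q e / a = c, cleared of denominators.
    Ratio : Fin r → ℕ × ℕ → ℕ × ℕ → Set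
    Ratio i (_ , a) (_ , e) = ∃[ c ] c ∈ C i × suc p * e ≡ c * (suc b * a)

    -- From level `suc b * a` on, `e` is a multiple `t * (suc b * a)`, so q e / a is the positive
    -- integer `suc p * t`.
    ratio-coloured : ∀ {x} → x ∈ Levelled →
                     ∃[ n ] (∀ {y} → y ∈ Levelled → n ≤ⁿ proj₁ y → ∃[ i ] Ratio i x y)
    ratio-coloured {n , a} (a≢0 , _) = suc b * a , coloured
      where
      instance
        ba≢0 : NonZero (suc b * a)
        ba≢0 = m*n≢0 (suc b) a {{_}} {{a≢0}}
      coloured : ∀ {y} → y ∈ Levelled → suc b * a ≤ⁿ proj₁ y → ∃[ i ] Ratio i (n , a) y
      coloured {m , e} (e≢0 , m!∣e) le with ∣-trans (n∣n! (suc b * a)) (∣-trans (m≤n⇒m!∣n! le) m!∣e)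
      ... | divides t refl = proj₁ found , suc p * t , proj₂ found , sym (*-assoc (suc p) t (suc b * a))
        where
        found : ∃[ i ] (suc p * t) ∈ C i
        found = covers (suc p * t) {{m*n≢0 (suc p) t {{_}} {{m*n≢0⇒m≢0 t {{e≢0}}}}}}

    module Rescaled
      {m} (d : ℕ → ℕ × ℕ) (d∈ : ∀ i → d i ∈ Levelled)
      (homogeneous : ∀ {n k l x y} → Block d n k x → Block d k l y → Ratio m x y)
      .(cop : Coprime (suc p) (suc b))
      where

      k : ℕ
      k = suc b * proj₂ (d 0)

      instance
        k≢0 : NonZero k
        k≢0 = m*n≢0 (suc b) _ {{_}} {{proj₁ (d∈ 0)}}

      d₀ : Block d 0 1 (d 0)
      d₀ = single z≤n ≤-refl

      xs : ∀ i → Ratio m (d 0) (d (suc i))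
      xs i = homogeneous d₀ (single (s≤s z≤n) ≤-refl)

      -- The shift sets `d 0` aside as common divisor: `x i` is the natural number q times `y i`
      -- over `proj₂ (d 0)`, provided by `Ratio`.
      x y : ℕ → ℕ
      x i = proj₁ (xs i)
      y i = proj₂ (d (suc i))

      x≢0 : ∀ i → NonZero (x i)
      x≢0 i = class-positive (proj₁ (proj₂ (xs i)))

      ∑-proportional : ∀ F → suc p * ∑[ F ] y ≡ ∑[ F ] x * k
      ∑-proportional F =
        *-sum-proportional (suc p) k x y (λ i → proj₂ (proj₂ (xs i))) (toList (elements F))

      ∑-block : ∀ {n m} F → n ≤ⁿ head (elements F) → maxᶠ F <ⁿ m →
                ∃[ z ] Block d (suc n) (suc m) z × proj₂ z ≡ ∑[ F ] y
      ∑-block F n≤ max<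
        with sum-block (λ i → d (suc i)) n≤
               (All.map (λ le → ≤-<-trans le max<) (elements≤max F)) (increasing F)
      ... | z , bl , eq = z , block-shift bl , eq

      -- Homogeneity for `d 0` and the block over the shifted `F` yields a number of colour `m`;
      -- cancelling `k` identifies it with the sum.
      ∑-coloured : ∀ F → ∑[ F ] x ∈ C m
      ∑-coloured F with ∑-block F z≤n ≤-refl
      ... | z , bl , eq with homogeneous d₀ bl
      ...   | c , c∈ , ceq =
        subst (C m) (*-cancelʳ-≡ c (∑[ F ] x) k
          (trans (sym ceq) (trans (cong (suc p *_) eq) (∑-proportional F)))) c∈

      quotient-coloured : ∀ F G → F <ᶠ G →
        ∃[ c ] c ∈ C m × suc p * ∑[ G ] x ≡ c * (suc b * ∑[ F ] x)
      quotient-coloured F G@(mkFinSet⁺ (g ∷ gs) _) F<G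
        -- Both blocks share the cut `suc (suc (maxᶠ F))`, as `homogeneous` requires: the head of
        -- `G` is at least `minᶠ G`, hence exceeds `maxᶠ F`.
        with ∑-block F z≤n ≤-refl | ∑-block G (<-≤-trans F<G (min≤⊤ g gs)) ≤-refl
      ... | z , bl , eq | z′ , bl′ , eq′ with homogeneous bl bl′
      ...   | c , c∈ , ceq = c , c∈ , rescale (suc p) (suc b) c k
        (trans (cong (suc p *_) (sym eq′)) (trans ceq (cong (λ t → c * (suc b * t)) eq)))
        (∑-proportional F) (∑-proportional G)

      monochromatic : ∃[ m ] Σ[ x ∈ (ℕ → ℕ) ] Σ[ x≢0 ∈ (∀ i → NonZero (x i)) ]
        (inℚ (FS x) ∪ Quotients (mkℚ (+ suc p) b cop) x x≢0) ⊆ inℚ (C m)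
      monochromatic = m , x , x≢0 , λ where
        (inj₁ (_ , (F , refl) , refl)) → _ , ∑-coloured F , refl
        (inj₂ (F , G , F<G , refl))    →
          let (c , c∈ , eq) = quotient-coloured F G F<G
          in  c , c∈ , scaled-quotient (suc p) b c (∑[ G ] x) (∑[ F ] x) {{∑-nonZero x≢0 F}} eq

corollary1p6 : (∀ {ℓ} → ExcludedMiddle ℓ) →
    ∀ (r : ℕ) (C : Fin r → Pred ℕ 0ℓ) → IsColouring C →
    ∀ (q : ℚ) → 0ℚ < q →
    ∃[ m ] Σ[ x ∈ (ℕ → ℕ) ] Σ[ x≢0 ∈ (∀ i → NonZero (x i)) ]
    (inℚ (FS x) ∪ Quotients q x x≢0) ⊆ inℚ (C m)
corollary1p6 em r C colouring (mkℚ (+ zero) b cop) (*<* (ℤ.+<+ ()))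
corollary1p6 em r C colouring (mkℚ -[1+ _ ] b cop) (*<* ())
corollary1p6 em r C colouring (mkℚ (+ suc p) b cop) _ =
  let (m , d , d∈ , homogeneous) = millikenTaylor Ratio (levelled-good em) (λ {x} → ratio-coloured {x})
  in  Rescaled.monochromatic d d∈ homogeneous cop
  where
  open Construction em C colouring p b
  open MillikenTaylor em _⊕_ ⊕-assoc proj₁ (λ _ _ → refl)
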